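{- For each real number $\epsilon>0$ and each integer $m\ge 3$ there is a positive integer $n$ and a subset $S\subseteq\mathbb{Z}/n\mathbb{Z}$ with $|S|\ge(1-\epsilon)n$ such that $S$ is simultaneously $(k,j)$-product-free for all positive integers $k>j$ with $k+j\le m$.
   Context: For positive integers $k,j$, a subset $S\subseteq\mathbb{Z}/n\mathbb{Z}$ is called $(k,j)$-product-free if there is no solution of $a_1a_2\cdots a_k\equiv b_1b_2\cdots b_j\pmod n$ with all $a_1,\dots,a_k,b_1,\dots,b_j\in S$ (not necessarily distinct). -}

module Defs where

open import Data.Fin.Base using (Fin; toℕ)
open import Data.Fin.Subset using (Subset; _∈_)
open import Data.Integer.Base as ℤ using (+_)
open import Data.Integer.Divisibility using (_∣_)
open import Data.Nat.Base as ℕ using (ℕ; _⊔_)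
import Data.Nat.Properties as ℕₚ
open import Data.Product.Base using (_,_; _×_; ∃-syntax)
open import Data.Rational.Base using (ℚ; 0ℚ; 1ℚ; ½; _+_; _-_; _*_; _/_; 1/_; ∣_∣; _≤_; _<_; positive; nonNegative; Positive)
open import Data.Rational.Properties
open import Data.Vec.Base as Vec using (Vec)
open import Data.Vec.Relation.Unary.All using (All)
open import Relation.Binary.PropositionalEquality using (_≡_; refl; sym; trans; cong; cong₂; subst)
open import Level using (0ℓ)
open import Relation.Nullary.Decidable.Core using (dec⇒maybe)
open import Relation.Nullary.Negation using (¬_)
open import Tactic.RingSolver using (solve-∀)
open import Tactic.RingSolver.Core.AlmostCommutativeRing using (AlmostCommutativeRing; fromCommutativeRing)

-- Product-free subsets of ℤ/nℤ.  The residue classes are represented by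
-- Fin n = {0, …, n-1}, and congruence modulo n is tested on the product of
-- the representatives, computed in ℕ.

infix 4 _≡_[mod_]

_≡_[mod_] : ℕ → ℕ → ℕ → Set
x ≡ y [mod n ] = + n ∣ + x ℤ.- + y

∏ : ∀ {n k} → Vec (Fin n) k → ℕ
∏ as = Vec.foldr′ ℕ._*_ 1 (Vec.map toℕ as)

ProductFree : ∀ {n} → ℕ → ℕ → Subset n → Set
ProductFree {n} k j S =
  ∀ (as : Vec (Fin n) k) (bs : Vec (Fin n) j) →
  All (_∈ S) as → All (_∈ S) bs → ¬ (∏ as ≡ ∏ bs [mod n ])

-- Real numbers as Cauchy sequences of rationals.  Two sequences denote the
-- same real when each is ≤ᵣ the other; no quotient is taken.

Cauchy : (ℕ → ℚ) → Set
Cauchy x = ∀ δ → 0ℚ < δ →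
  ∃[ N ] (∀ k l → N ℕ.≤ k → N ℕ.≤ l → ∣ x k - x l ∣ ≤ δ)

record ℝ : Set where
  constructor mkℝ
  field
    seq    : ℕ → ℚ
    cauchy : Cauchy seq

open ℝ public

infix 4 _≤ᵣ_ _<ᵣ_

_<ᵣ_ : ℝ → ℝ → Set
x <ᵣ y = ∃[ δ ] (0ℚ < δ × ∃[ N ] (∀ k → N ℕ.≤ k → seq x k + δ ≤ seq y k))

-- Equivalent to ¬ (y <ᵣ x).
_≤ᵣ_ : ℝ → ℝ → Set
x ≤ᵣ y = ∀ δ → 0ℚ < δ → ∃[ N ] (∀ k → N ℕ.≤ k → seq x k ≤ seq y k + δ)

fromℚ : ℚ → ℝ
fromℚ q = mkℝ (λ _ → q) λ δ 0<δ →
  0 , λ _ _ _ _ → subst (λ r → ∣ r ∣ ≤ δ) (sym (+-inverseʳ q)) (<⇒≤ 0<δ)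

fromℕ : ℕ → ℝ
fromℕ n = fromℚ (+ n / 1)

0ℝ 1ℝ : ℝ
0ℝ = fromℕ 0
1ℝ = fromℕ 1

private
  ℚ-ring : AlmostCommutativeRing 0ℓ 0ℓ
  ℚ-ring = fromCommutativeRing +-*-commutativeRing λ q → dec⇒maybe (0ℚ ≟ q)

  half>0 : ∀ {δ} → 0ℚ < δ → 0ℚ < ½ * δ
  half>0 {δ} 0<δ = positive⁻¹ (½ * δ) {{pos*pos⇒pos ½ δ {{positive 0<δ}}}}

  half+half : ∀ δ → ½ * δ + ½ * δ ≡ δ
  half+half δ = trans (sym (*-distribʳ-+ δ ½ ½)) (*-identityˡ δ)

  minus-rearrange : ∀ a b c d → (a - b) - (c - d) ≡ (a - c) - (b - d)
  minus-rearrange = solve-∀ ℚ-ring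

  times-rearrange : ∀ a b c d → a * b - c * d ≡ a * (b - d) + (a - c) * d
  times-rearrange = solve-∀ ℚ-ring

  plus-minus : ∀ a b → a ≡ (a - b) + b
  plus-minus = solve-∀ ℚ-ring

  ∣∣*-mono : ∀ {p q r s} → 0ℚ ≤ r → ∣ p ∣ ≤ r → ∣ q ∣ ≤ s → ∣ p * q ∣ ≤ r * s
  ∣∣*-mono {p} {q} {r} {s} 0≤r p≤r q≤s = begin
    ∣ p * q ∣      ≡⟨ ∣p*q∣≡∣p∣*∣q∣ p q ⟩
    ∣ p ∣ * ∣ q ∣  ≤⟨ *-monoʳ-≤-nonNeg ∣ q ∣ {{∣-∣-nonNeg q}} p≤r ⟩
    r * ∣ q ∣      ≤⟨ *-monoˡ-≤-nonNeg r {{nonNegative 0≤r}} q≤s ⟩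
    r * s          ∎
    where open ≤-Reasoning

  eventuallyBounded : ∀ x → Cauchy x →
    ∃[ B ] (0ℚ < B × ∃[ N ] (∀ k → N ℕ.≤ k → ∣ x k ∣ ≤ B))
  eventuallyBounded x cx with cx 1ℚ (positive⁻¹ 1ℚ)
  ... | N , h = 1ℚ + ∣ x N ∣
              , positive⁻¹ (1ℚ + ∣ x N ∣) {{pos+nonNeg⇒pos 1ℚ ∣ x N ∣ {{∣-∣-nonNeg (x N)}}}}
              , N , bound
    where
    open ≤-Reasoning
    bound : ∀ k → N ℕ.≤ k → ∣ x k ∣ ≤ 1ℚ + ∣ x N ∣
    bound k N≤k = begin
      ∣ x k ∣                  ≡⟨ cong ∣_∣ (plus-minus (x k) (x N)) ⟩
      ∣ (x k - x N) + x N ∣    ≤⟨ ∣p+q∣≤∣p∣+∣q∣ (x k - x N) (x N) ⟩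
      ∣ x k - x N ∣ + ∣ x N ∣  ≤⟨ +-monoˡ-≤ ∣ x N ∣ (h k N N≤k ℕₚ.≤-refl) ⟩
      1ℚ + ∣ x N ∣             ∎

  -- The precision η with B * η ≡ δ.
  divide : ∀ B δ → 0ℚ < B → 0ℚ < δ → ∃[ η ] (0ℚ < η × B * η ≡ δ)
  divide B δ 0<B 0<δ = 1/B * δ , positive⁻¹ (1/B * δ) {{pos*pos⇒pos 1/B {{1/pos⇒pos B}} δ {{positive 0<δ}}}}
                     , trans (sym (*-assoc B 1/B δ))
                             (trans (cong (_* δ) (*-inverseʳ B)) (*-identityˡ δ))
    where
    instance
      B-pos : Positive B
      B-pos = positive 0<B
      B-nonZero = pos⇒nonZero B
    1/B = 1/ B

  minus-cauchy : ∀ x y → Cauchy x → Cauchy y → Cauchy (λ k → x k - y k)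
  minus-cauchy x y cx cy δ 0<δ
    with cx (½ * δ) (half>0 0<δ) | cy (½ * δ) (half>0 0<δ)
  ... | M , f | N , g = M ⊔ N , λ k l p q → begin
    ∣ (x k - y k) - (x l - y l) ∣      ≡⟨ cong ∣_∣ (minus-rearrange (x k) (y k) (x l) (y l)) ⟩
    ∣ (x k - x l) - (y k - y l) ∣      ≤⟨ ∣p-q∣≤∣p∣+∣q∣ (x k - x l) (y k - y l) ⟩
    ∣ x k - x l ∣ + ∣ y k - y l ∣      ≤⟨ +-mono-≤ (f k l (ℕₚ.m⊔n≤o⇒m≤o M N p) (ℕₚ.m⊔n≤o⇒m≤o M N q))
                                                   (g k l (ℕₚ.m⊔n≤o⇒n≤o M N p) (ℕₚ.m⊔n≤o⇒n≤o M N q)) ⟩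
    ½ * δ + ½ * δ                      ≡⟨ half+half δ ⟩
    δ                                  ∎
    where open ≤-Reasoning

  estimate : ∀ A B η θ δ → 0ℚ ≤ A → 0ℚ ≤ η → B * η ≡ ½ * δ → A * θ ≡ ½ * δ →
    ∀ a b c d → ∣ a ∣ ≤ A → ∣ d ∣ ≤ B → ∣ a - c ∣ ≤ η → ∣ b - d ∣ ≤ θ →
    ∣ a * b - c * d ∣ ≤ δ
  estimate A B η θ δ 0≤A 0≤η Bη≡ Aθ≡ a b c d a≤A d≤B a-c≤η b-d≤θ = begin
    ∣ a * b - c * d ∣                      ≡⟨ cong ∣_∣ (times-rearrange a b c d) ⟩
    ∣ a * (b - d) + (a - c) * d ∣          ≤⟨ ∣p+q∣≤∣p∣+∣q∣ (a * (b - d)) ((a - c) * d) ⟩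
    ∣ a * (b - d) ∣ + ∣ (a - c) * d ∣      ≤⟨ +-mono-≤ (∣∣*-mono {a} {b - d} 0≤A a≤A b-d≤θ)
                                                       (∣∣*-mono {a - c} {d} 0≤η a-c≤η d≤B) ⟩
    A * θ + η * B                          ≡⟨ cong₂ _+_ Aθ≡ (trans (*-comm η B) Bη≡) ⟩
    ½ * δ + ½ * δ                          ≡⟨ half+half δ ⟩
    δ                                      ∎
    where open ≤-Reasoning

  times-cauchy : ∀ x y → Cauchy x → Cauchy y → Cauchy (λ k → x k * y k)
  times-cauchy x y cx cy δ 0<δ =
    let A , 0<A , K , bx = eventuallyBounded x cx
        B , 0<B , L , by = eventuallyBounded y cy
        η , 0<η , Bη≡    = divide B (½ * δ) 0<B (half>0 0<δ)
        θ , 0<θ , Aθ≡    = divide A (½ * δ) 0<A (half>0 0<δ)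
        M , f            = cx η 0<η
        N , g            = cy θ 0<θ
    in (K ⊔ L) ⊔ (M ⊔ N) , λ k l p q →
      let K⊔L≤k = ℕₚ.m⊔n≤o⇒m≤o (K ⊔ L) (M ⊔ N) p
          K⊔L≤l = ℕₚ.m⊔n≤o⇒m≤o (K ⊔ L) (M ⊔ N) q
          M⊔N≤k = ℕₚ.m⊔n≤o⇒n≤o (K ⊔ L) (M ⊔ N) p
          M⊔N≤l = ℕₚ.m⊔n≤o⇒n≤o (K ⊔ L) (M ⊔ N) q
      in estimate A B η θ δ (<⇒≤ 0<A) (<⇒≤ 0<η) Bη≡ Aθ≡
           (x k) (y k) (x l) (y l)
           (bx k (ℕₚ.m⊔n≤o⇒m≤o K L K⊔L≤k))
           (by l (ℕₚ.m⊔n≤o⇒n≤o K L K⊔L≤l))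
           (f k l (ℕₚ.m⊔n≤o⇒m≤o M N M⊔N≤k) (ℕₚ.m⊔n≤o⇒m≤o M N M⊔N≤l))
           (g k l (ℕₚ.m⊔n≤o⇒n≤o M N M⊔N≤k) (ℕₚ.m⊔n≤o⇒n≤o M N M⊔N≤l))

infixl 6 _-ᵣ_
infixl 7 _*ᵣ_

_-ᵣ_ _*ᵣ_ : ℝ → ℝ → ℝ
x -ᵣ y = mkℝ (λ k → seq x k - seq y k) (minus-cauchy (seq x) (seq y) (cauchy x) (cauchy y))
x *ᵣ y = mkℝ (λ k → seq x k * seq y k) (times-cauchy (seq x) (seq y) (cauchy x) (cauchy y))

{-# OPTIONS --safe #-}
-- Take primes p ∈ ps with ∑ 1/p large (Erdős' argument) and all of them beyond 2E, and put
-- n = (∏ p)^m.  For a random residue a mod n, the number ω(a) of p ∈ ps dividing a has mean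
-- and variance about ∑ 1/p, so by Chebyshev ω(a) lies within a factor 1 ± 1/(m+1) of its mean
-- for most a; and few a have some p² as a divisor, as ∑ 1/p² ≤ 1/(2E) ≤ ε/2.  Let S consist of the a
-- with both properties.  On a product of at most m elements of S the p-adic valuation is
-- determined mod p^m ∣ n, and it counts the factors divisible by p.  Hence if a product of k
-- elements is congruent to one of j elements, the values of ω have the same sum on both sides;
-- but these sums are about k and j times the mean, which is impossible when k ≠ j and k + j ≤ m.
module Submission where

open import Defs
open import Data.Fin.Base using (Fin; toℕ)
import Data.Fin.Subset as Subset
open import Data.Fin.Subset using (Subset; ∣_∣)
import Data.Integer.Base as ℤ
import Data.Integer.Divisibility.Signed as ℤ
import Data.Integer.Properties as ℤ
open import Data.List.Base using (List; []; _∷_; _++_; map; filter; upTo; applyUpTo; length)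
open import Data.List.Membership.Propositional using (_∈_)
open import Data.List.Membership.Propositional.Properties using (∈-filter⁺; ∈-applyUpTo⁺; ∈-upTo⁺)
open import Data.List.Properties using (map-++; map-∘; map-upTo; upTo-∷ʳ; length-upTo)
open import Data.List.Relation.Unary.All as All using (All; []; _∷_)
import Data.List.Relation.Unary.All.Properties as All
open import Data.List.Relation.Unary.AllPairs using (AllPairs; []; _∷_)
import Data.List.Relation.Unary.AllPairs.Properties as AllPairs
open import Data.List.Relation.Unary.Any as Any using (Any; here; there)
open import Data.Nat.Base
open import Data.Nat.Divisibility
open import Data.Nat.ListAction using (sum; product)
open import Data.Nat.ListAction.Properties using (sum-++; ∈⇒∣product)
open import Data.Nat.Primality
open import Data.Nat.Primality.Factorisation using (factorise)
open import Data.Nat.Properties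
open import Data.Nat.Tactic.RingSolver using (solve-∀)
open import Data.Product.Base using (_×_; _,_; ∃₂; ∃-syntax; Σ-syntax; proj₁)
import Data.Rational.Base as ℚ
open import Data.Rational.Base using (ℚ; 0ℚ; 1ℚ; mkℚ; *<*; toℚᵘ)
import Data.Rational.Properties as ℚ
open import Data.Rational.Solver using (module +-*-Solver)
import Data.Rational.Unnormalised.Base as ℚᵘ
open import Data.Rational.Unnormalised.Base using (mkℚᵘ; *≡*; *≤*)
import Data.Rational.Unnormalised.Properties as ℚᵘ
open import Data.Sum.Base using (_⊎_; inj₁; inj₂; [_,_]′)
open import Data.Vec.Base as Vec using (Vec; []; _∷_; tabulate; toList)
import Data.Vec.Properties as Vec
open import Data.Vec.Relation.Unary.All as VecAll using ([]; _∷_)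
open import Function.Base using (_∘_)
open import Relation.Binary.PropositionalEquality hiding ([_])
open import Relation.Nullary

private
  variable
    A B : Set
    P Q : Set

-- Natural numbers as rationals

natural : ℕ → ℚ
natural n = ℤ.+ n ℚ./ 1

toℚᵘ-natural : ∀ n → toℚᵘ (natural n) ℚᵘ.≃ mkℚᵘ (ℤ.+ n) 0
toℚᵘ-natural n = ℚ.toℚᵘ-fromℚᵘ (mkℚᵘ (ℤ.+ n) 0)

natural-+ : ∀ m n → natural (m + n) ≡ natural m ℚ.+ natural n
natural-+ m n = ℚ.toℚᵘ-injective (begin
  toℚᵘ (natural (m + n))                   ≈⟨ toℚᵘ-natural (m + n) ⟩
  mkℚᵘ (ℤ.+ (m + n)) 0                       ≈⟨ *≡* (cong (ℤ._* ℤ.+ 1) (cong₂ ℤ._+_ (sym (ℤ.*-identityʳ (ℤ.+ m))) (sym (ℤ.*-identityʳ (ℤ.+ n))))) ⟩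
  mkℚᵘ (ℤ.+ m) 0 ℚᵘ.+ mkℚᵘ (ℤ.+ n) 0           ≈⟨ ℚᵘ.+-cong (toℚᵘ-natural m) (toℚᵘ-natural n) ⟨
  toℚᵘ (natural m) ℚᵘ.+ toℚᵘ (natural n)   ≈⟨ ℚ.toℚᵘ-homo-+ (natural m) (natural n) ⟨
  toℚᵘ (natural m ℚ.+ natural n)           ∎)
  where open ℚᵘ.≃-Reasoning

natural-* : ∀ m n → natural (m * n) ≡ natural m ℚ.* natural n
natural-* m n = ℚ.toℚᵘ-injective (begin
  toℚᵘ (natural (m * n))                   ≈⟨ toℚᵘ-natural (m * n) ⟩
  mkℚᵘ (ℤ.+ (m * n)) 0                       ≈⟨ *≡* (cong (ℤ._* ℤ.+ 1) (ℤ.pos-* m n)) ⟩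
  mkℚᵘ (ℤ.+ m) 0 ℚᵘ.* mkℚᵘ (ℤ.+ n) 0           ≈⟨ ℚᵘ.*-cong (toℚᵘ-natural m) (toℚᵘ-natural n) ⟨
  toℚᵘ (natural m) ℚᵘ.* toℚᵘ (natural n)   ≈⟨ ℚ.toℚᵘ-homo-* (natural m) (natural n) ⟨
  toℚᵘ (natural m ℚ.* natural n)           ∎)
  where open ℚᵘ.≃-Reasoning

natural-mono : ∀ {m n} → m ≤ n → natural m ℚ.≤ natural n
natural-mono {m} {n} m≤n = ℚ.toℚᵘ-cancel-≤ (begin
  toℚᵘ (natural m)   ≃⟨ toℚᵘ-natural m ⟩
  mkℚᵘ (ℤ.+ m) 0       ≤⟨ *≤* (ℤ.*-monoʳ-≤-nonNeg (ℤ.+ 1) (ℤ.+≤+ m≤n)) ⟩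
  mkℚᵘ (ℤ.+ n) 0       ≃⟨ toℚᵘ-natural n ⟨
  toℚᵘ (natural n)   ∎)
  where open ℚᵘ.≤-Reasoning

archimedean : ∀ δ → 0ℚ ℚ.< δ → ∃[ E ] (0 < E × 1ℚ ℚ.≤ natural E ℚ.* δ)
archimedean (mkℚ (ℤ.+ 0) d _)       (*<* (ℤ.+<+ ()))
archimedean (mkℚ ℤ.-[1+ _ ] d _)  (*<* ())
archimedean δ@(mkℚ (ℤ.+ suc a) d _) _ = suc d , z<s , ℚ.toℚᵘ-cancel-≤ (begin
  mkℚᵘ (ℤ.+ 1) 0                               ≤⟨ *≤* (ℤ.+≤+ d≤da) ⟩
  mkℚᵘ (ℤ.+ suc d) 0 ℚᵘ.* toℚᵘ δ               ≃⟨ ℚᵘ.*-congʳ {toℚᵘ δ} (toℚᵘ-natural (suc d)) ⟨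
  toℚᵘ (natural (suc d)) ℚᵘ.* toℚᵘ δ         ≃⟨ ℚ.toℚᵘ-homo-* (natural (suc d)) δ ⟨
  toℚᵘ (natural (suc d) ℚ.* δ)               ∎)
  where
  open ℚᵘ.≤-Reasoning
  d≤da : 1 * suc (d + 0) ≤ suc d * suc a * 1
  d≤da = ≤-trans (≤-reflexive (unit d)) (≤-trans (m≤m*n (suc d) (suc a)) (≤-reflexive (sym (*-identityʳ _))))
    where
    unit : ∀ d → 1 * suc (d + 0) ≡ suc d
    unit = solve-∀

density-bound-at : ∀ {E n s e} → 0 < E → E * n ≤ E * s + n → 1ℚ ℚ.≤ natural E ℚ.* e →
  (1ℚ ℚ.- e) ℚ.* natural n ℚ.≤ natural s
density-bound-at {E} {n} {s} {e} 0<E En≤ 1≤Ee = ℚ.*-cancelˡ-≤-pos (natural E) {{E-pos}} (begin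
  natural E ℚ.* ((1ℚ ℚ.- e) ℚ.* natural n)
    ≡⟨ expand (natural E) e (natural n) ⟩
  natural E ℚ.* natural n ℚ.- natural E ℚ.* e ℚ.* natural n
    ≡⟨ cong (ℚ._- natural E ℚ.* e ℚ.* natural n) (natural-* E n) ⟨
  natural (E * n) ℚ.- natural E ℚ.* e ℚ.* natural n
    ≤⟨ ℚ.+-mono-≤ (natural-mono En≤) (ℚ.neg-antimono-≤ (ℚ.*-monoʳ-≤-nonNeg (natural n) {{n-nonNeg}} 1≤Ee)) ⟩
  natural (E * s + n) ℚ.- 1ℚ ℚ.* natural n
    ≡⟨ cong (ℚ._- 1ℚ ℚ.* natural n) (trans (natural-+ (E * s) n) (cong (ℚ._+ natural n) (natural-* E s))) ⟩
  natural E ℚ.* natural s ℚ.+ natural n ℚ.- 1ℚ ℚ.* natural n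
    ≡⟨ cancel (natural E ℚ.* natural s) (natural n) ⟩
  natural E ℚ.* natural s ∎)
  where
  open ℚ.≤-Reasoning
  open +-*-Solver
  E-pos : ℚ.Positive (natural E)
  E-pos = ℚ.positive (ℚ.<-≤-trans (ℚ.positive⁻¹ 1ℚ) (natural-mono 0<E))
  n-nonNeg : ℚ.NonNegative (natural n)
  n-nonNeg = ℚ.nonNegative (natural-mono {0} {n} z≤n)
  expand : ∀ E e n → E ℚ.* ((1ℚ ℚ.- e) ℚ.* n) ≡ E ℚ.* n ℚ.- E ℚ.* e ℚ.* n
  expand = solve 3 (λ E e n → E :* ((con 1ℚ :- e) :* n) := E :* n :- E :* e :* n) refl
  cancel : ∀ a n → a ℚ.+ n ℚ.- 1ℚ ℚ.* n ≡ a
  cancel = solve 2 (λ a n → a :+ n :- con 1ℚ :* n := a) refl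

density-bound : ∀ {E n s δ} → 0 < E → E * n ≤ E * s + n → 1ℚ ℚ.≤ natural E ℚ.* δ →
  ∀ e → 0ℚ ℚ.+ δ ℚ.≤ e → ∀ η → 0ℚ ℚ.< η → (1ℚ ℚ.- e) ℚ.* natural n ℚ.≤ natural s ℚ.+ η
density-bound {E} {n} {s} {δ} 0<E dense 1≤Eδ e δ≤e η 0<η = begin
  (1ℚ ℚ.- e) ℚ.* natural n  ≤⟨ density-bound-at {E} {n} {s} {e} 0<E dense 1≤Ee ⟩
  natural s                 ≡⟨ ℚ.+-identityʳ (natural s) ⟨
  natural s ℚ.+ 0ℚ          ≤⟨ ℚ.+-monoʳ-≤ (natural s) (ℚ.<⇒≤ 0<η) ⟩
  natural s ℚ.+ η           ∎
  where
  open ℚ.≤-Reasoning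
  1≤Ee : 1ℚ ℚ.≤ natural E ℚ.* e
  1≤Ee = begin
    1ℚ                         ≤⟨ 1≤Eδ ⟩
    natural E ℚ.* δ            ≡⟨ cong (natural E ℚ.*_) (ℚ.+-identityˡ δ) ⟨
    natural E ℚ.* (0ℚ ℚ.+ δ)   ≤⟨ ℚ.*-monoˡ-≤-nonNeg (natural E) {{ℚ.nonNegative (natural-mono {0} {E} z≤n)}} δ≤e ⟩
    natural E ℚ.* e            ∎

-- Finite sums and counting

∑ : List A → (A → ℕ) → ℕ
∑ xs f = sum (map f xs)

∑-mono : ∀ {xs : List A} {f g} → All (λ x → f x ≤ g x) xs → ∑ xs f ≤ ∑ xs g
∑-mono []       = z≤n
∑-mono (p ∷ ps) = +-mono-≤ p (∑-mono ps)

∑-cong : ∀ {xs : List A} {f g} → All (λ x → f x ≡ g x) xs → ∑ xs f ≡ ∑ xs g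
∑-cong []       = refl
∑-cong (p ∷ ps) = cong₂ _+_ p (∑-cong ps)

∑-distrib-+ : ∀ (xs : List A) f g → ∑ xs (λ x → f x + g x) ≡ ∑ xs f + ∑ xs g
∑-distrib-+ []       f g = refl
∑-distrib-+ (x ∷ xs) f g rewrite ∑-distrib-+ xs f g = interchange (f x) (g x) (∑ xs f) (∑ xs g)
  where
  interchange : ∀ a b c d → a + b + (c + d) ≡ a + c + (b + d)
  interchange = solve-∀

∑-distribˡ-* : ∀ (xs : List A) c f → ∑ xs (λ x → c * f x) ≡ c * ∑ xs f
∑-distribˡ-* []       c f = sym (*-zeroʳ c)
∑-distribˡ-* (x ∷ xs) c f rewrite ∑-distribˡ-* xs c f = sym (*-distribˡ-+ c (f x) (∑ xs f))

∑-const : ∀ (xs : List A) c → ∑ xs (λ _ → c) ≡ length xs * c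
∑-const []       c = refl
∑-const (x ∷ xs) c = cong (c +_) (∑-const xs c)

∑-swap : ∀ (xs : List A) (ys : List B) (f : A → B → ℕ) → ∑ xs (λ x → ∑ ys (f x)) ≡ ∑ ys (λ y → ∑ xs (λ x → f x y))
∑-swap []       ys f = sym (trans (∑-const ys 0) (*-zeroʳ (length ys)))
∑-swap (x ∷ xs) ys f = begin
  ∑ ys (f x) + ∑ xs (λ x → ∑ ys (f x))            ≡⟨ cong (∑ ys (f x) +_) (∑-swap xs ys f) ⟩
  ∑ ys (f x) + ∑ ys (λ y → ∑ xs (λ x → f x y))    ≡⟨ ∑-distrib-+ ys (f x) (λ y → ∑ xs (λ x → f x y)) ⟨
  ∑ ys (λ y → ∑ (x ∷ xs) (λ x → f x y))           ∎
  where open ≡-Reasoning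

∑-++ : ∀ (xs ys : List A) f → ∑ (xs ++ ys) f ≡ ∑ xs f + ∑ ys f
∑-++ xs ys f = trans (cong sum (map-++ f xs ys)) (sum-++ (map f xs) (map f ys))

∈⇒≤∑ : ∀ {x} {xs : List A} f → x ∈ xs → f x ≤ ∑ xs f
∈⇒≤∑ f (here refl)           = m≤m+n _ _
∈⇒≤∑ {xs = y ∷ _} f (there x∈xs) = ≤-trans (∈⇒≤∑ f x∈xs) (m≤n+m _ (f y))

∑-upTo-last : ∀ n f → ∑ (upTo (suc n)) f ≡ ∑ (upTo n) f + f n
∑-upTo-last n f = begin
  ∑ (upTo (suc n)) f        ≡⟨ cong (λ xs → ∑ xs f) (upTo-∷ʳ n) ⟨
  ∑ (upTo n ++ n ∷ []) f    ≡⟨ ∑-++ (upTo n) (n ∷ []) f ⟩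
  ∑ (upTo n) f + (f n + 0)  ≡⟨ cong (∑ (upTo n) f +_) (+-identityʳ (f n)) ⟩
  ∑ (upTo n) f + f n        ∎
  where open ≡-Reasoning

∑-upTo-head : ∀ n f → ∑ (upTo (suc n)) f ≡ f 0 + ∑ (upTo n) (f ∘ suc)
∑-upTo-head n f = cong (λ xs → f 0 + sum xs)
  (trans (cong (map f) (sym (map-upTo suc n))) (sym (map-∘ (upTo n))))

∑-upTo-const : ∀ n c → ∑ (upTo n) (λ _ → c) ≡ n * c
∑-upTo-const n c = trans (∑-const (upTo n) c) (cong (_* c) (length-upTo n))

⟦_⟧ : Dec P → ℕ
⟦ yes _ ⟧ = 1
⟦ no  _ ⟧ = 0

⟦⟧-true : (d : Dec P) → P → ⟦ d ⟧ ≡ 1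
⟦⟧-true (yes _) _ = refl
⟦⟧-true (no ¬p) p = contradiction p ¬p

⟦⟧-false : (d : Dec P) → ¬ P → ⟦ d ⟧ ≡ 0
⟦⟧-false (yes p) ¬p = contradiction p ¬p
⟦⟧-false (no _)  _  = refl

⟦⟧-cong : (d : Dec P) (e : Dec Q) → (P → Q) → (Q → P) → ⟦ d ⟧ ≡ ⟦ e ⟧
⟦⟧-cong (yes p) e f g = sym (⟦⟧-true e (f p))
⟦⟧-cong (no ¬p) e f g = sym (⟦⟧-false e (¬p ∘ g))

⟦⟧-*-× : (d : Dec P) (e : Dec Q) → ⟦ d ⟧ * ⟦ e ⟧ ≡ ⟦ d ×-dec e ⟧
⟦⟧-*-× (yes _) (yes _) = refl
⟦⟧-*-× (yes _) (no _)  = refl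
⟦⟧-*-× (no _)  _       = refl

⟦⟧≤1 : (d : Dec P) → ⟦ d ⟧ ≤ 1
⟦⟧≤1 (yes _) = ≤-refl
⟦⟧≤1 (no _)  = z≤n

Any⇒1≤∑ : ∀ {R : A → Set} (R? : ∀ x → Dec (R x)) {xs} → Any R xs → 1 ≤ ∑ xs (λ x → ⟦ R? x ⟧)
Any⇒1≤∑ R? {x ∷ _} (here r)    = ≤-trans (≤-reflexive (sym (⟦⟧-true (R? x) r))) (m≤m+n _ _)
Any⇒1≤∑ R? {x ∷ _} (there any) = ≤-trans (Any⇒1≤∑ R? any) (m≤n+m _ ⟦ R? x ⟧)

∑⟦≡⟧≤1 : ∀ n c → ∑ (upTo n) (λ i → ⟦ suc i ≟ c ⟧) ≤ 1
∑⟦≡⟧≤1 n c = proj₁ (go n)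
  where
  go : ∀ n → ∑ (upTo n) (λ i → ⟦ suc i ≟ c ⟧) ≤ 1 ×
             (n < c → ∑ (upTo n) (λ i → ⟦ suc i ≟ c ⟧) ≡ 0)
  go zero = z≤n , λ _ → refl
  go (suc n) with go n
  ... | le , eq rewrite ∑-upTo-last n (λ i → ⟦ suc i ≟ c ⟧) with suc n ≟ c
  ...   | yes refl rewrite eq ≤-refl = ≤-refl , λ lt → contradiction lt (<-irrefl refl)
  ...   | no _     rewrite +-identityʳ (∑ (upTo n) (λ i → ⟦ suc i ≟ c ⟧)) = le , λ lt → eq (<-trans (n<1+n n) lt)

multiples : ∀ d n → .{{NonZero d}} →
  ∃[ r ] (r < d × d * ∑ (upTo n) (λ i → ⟦ d ∣? suc i ⟧) + r ≡ n)
multiples d zero    = 0 , >-nonZero⁻¹ d , trans (+-identityʳ _) (*-zeroʳ d)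
multiples d (suc n) with multiples d n
... | r , r<d , eq with d ∣? suc n | ∑-upTo-last n (λ i → ⟦ d ∣? suc i ⟧)
...   | yes d∣1+n | step = 0 , >-nonZero⁻¹ d , (begin
  d * ∑ (upTo (suc n)) χ + 0  ≡⟨ +-identityʳ _ ⟩
  d * ∑ (upTo (suc n)) χ      ≡⟨ cong (d *_) step ⟩
  d * (∑ (upTo n) χ + 1)      ≡⟨ *-distribˡ-+ d _ 1 ⟩
  d * ∑ (upTo n) χ + d * 1    ≡⟨ cong (d * ∑ (upTo n) χ +_) (trans (*-identityʳ d) (≤-antisym (∣⇒≤ d∣1+r) r<d)) ⟩
  d * ∑ (upTo n) χ + suc r    ≡⟨ trans (+-suc _ r) (cong suc eq) ⟩
  suc n                       ∎)
  where
  open ≡-Reasoning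
  χ = λ i → ⟦ d ∣? suc i ⟧
  d∣1+r : d ∣ suc r
  d∣1+r = ∣m+n∣m⇒∣n (subst (d ∣_) (sym (trans (+-suc _ r) (cong suc eq))) d∣1+n) (m∣m*n (∑ (upTo n) χ))
...   | no d∤1+n | step = suc r , ≤∧≢⇒< r<d 1+r≢d , (begin
  d * ∑ (upTo (suc n)) χ + suc r  ≡⟨ cong (λ s → d * s + suc r) (trans step (+-identityʳ _)) ⟩
  d * ∑ (upTo n) χ + suc r        ≡⟨ trans (+-suc _ r) (cong suc eq) ⟩
  suc n                           ∎)
  where
  open ≡-Reasoning
  χ = λ i → ⟦ d ∣? suc i ⟧
  1+r≢d : suc r ≢ d
  1+r≢d refl = d∤1+n (subst (d ∣_) (trans (+-suc _ r) (cong suc eq))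
    (∣m∣n⇒∣m+n (m∣m*n (∑ (upTo n) χ)) ∣-refl))

multiples-≤ : ∀ d n → .{{NonZero d}} → d * ∑ (upTo n) (λ i → ⟦ d ∣? suc i ⟧) ≤ n
multiples-≤ d n with multiples d n
... | r , _ , eq = ≤-trans (m≤m+n _ r) (≤-reflexive eq)

multiples-mod : ∀ {d n} → .{{NonZero d}} → d ∣ n → d * ∑ (upTo n) (λ a → ⟦ d ∣? a ⟧) ≡ n
multiples-mod {d} {n} d∣n with multiples d n
... | suc r , r<d , eq = contradiction r<d (≤⇒≯ (∣⇒≤ (∣m+n∣m⇒∣n (subst (d ∣_) (sym eq) d∣n) (m∣m*n _))))
... | zero  , _   , eq = trans (cong (d *_) shift) (trans (sym (+-identityʳ _)) eq)
  where
  open ≡-Reasoning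
  χ = λ a → ⟦ d ∣? a ⟧
  shift : ∑ (upTo n) χ ≡ ∑ (upTo n) (χ ∘ suc)
  shift = +-cancelʳ-≡ (χ n) _ _ (begin
    ∑ (upTo n) χ + χ n          ≡⟨ ∑-upTo-last n χ ⟨
    ∑ (upTo (suc n)) χ          ≡⟨ ∑-upTo-head n χ ⟩
    χ 0 + ∑ (upTo n) (χ ∘ suc)  ≡⟨ +-comm (χ 0) _ ⟩
    ∑ (upTo n) (χ ∘ suc) + χ 0  ≡⟨ cong (∑ (upTo n) (χ ∘ suc) +_) (⟦⟧-cong (d ∣? 0) (d ∣? n) (λ _ → d∣n) (λ _ → d ∣0)) ⟩
    ∑ (upTo n) (χ ∘ suc) + χ n  ∎)

open ≤-Reasoning

-- Divergence of ∑ 1/p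

squareDecomposition : ∀ P {as} → All Prime as → All (_∣ P) as →
  ∃₂ λ r s → r ∣ P × product as ≡ r * (s * s)
squareDecomposition P []       []         = 1 , 1 , 1∣ P , refl
squareDecomposition P {p ∷ as} (pp ∷ ps) (p∣P ∷ ds) with squareDecomposition P ps ds
... | r , s , r∣P , eq with p ∣? r
...   | yes (divides q refl) = q , p * s , ∣-trans (m∣m*n p) r∣P , trans (cong (p *_) eq) (rearrange p q s)
  where
  rearrange : ∀ p q s → p * (q * p * (s * s)) ≡ q * (p * s * (p * s))
  rearrange = solve-∀
...   | no p∤r = p * r , s , pr∣P r∣P , trans (cong (p *_) eq) (sym (*-assoc p r (s * s)))
  where
  pr∣P : r ∣ P → p * r ∣ P
  pr∣P (divides q refl) with euclidsLemma q r pp p∣P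
  ... | inj₁ p∣q = *-monoˡ-∣ r p∣q
  ... | inj₂ p∣r = contradiction p∣r p∤r

∣! : ∀ {p n} → .{{NonZero p}} → p ≤ n → p ∣ n !
∣! {suc p} p≤n = ∣-trans (m∣m*n (p !)) (m≤n⇒m!∣n! p≤n)

primesBetween : ℕ → ℕ → List ℕ
primesBetween N x = filter prime? (applyUpTo (N +_) x)

∈-primesBetween : ∀ {N x p} → Prime p → N ≤ p → p < N + x → p ∈ primesBetween N x
∈-primesBetween {N} {x} pp N≤p p<N+x with m≤n⇒∃[o]m+o≡n N≤p
... | i , refl = ∈-filter⁺ prime? (∈-applyUpTo⁺ (N +_) (+-cancelˡ-< N i x p<N+x)) pp

roughOrDecomposed : ∀ N x a → .{{NonZero a}} → a ≤ x →
  Any (_∣ a) (primesBetween N (suc x)) ⊎ (∃₂ λ r s → r ∣ N ! × a ≡ r * (s * s))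
roughOrDecomposed N x a a≤x with Any.any? (_∣? a) (primesBetween N (suc x))
... | yes any = inj₁ any
... | no none with factorise a
...   | record { factors = as ; isFactorisation = refl ; factorsPrime = ps } =
  inj₂ (squareDecomposition (N !) ps (All.tabulate smooth))
  where
  smooth : ∀ {p} → p ∈ as → p ∣ N !
  smooth {p} p∈as with p ≤? N
  ... | yes p≤N = ∣! {{prime⇒nonZero pp}} p≤N
    where pp = All.lookup ps p∈as
  ... | no p≰N = contradiction (Any.map (λ { refl → p∣a }) p∈primes) none
    where
    p∣a = ∈⇒∣product p∈as
    p∈primes = ∈-primesBetween (All.lookup ps p∈as) (<⇒≤ (≰⇒> p≰N))
      (≤-<-trans (∣⇒≤ p∣a) (≤-<-trans a≤x (m≤n+m (suc x) N)))

-- k ≤ 2 ∑ 1/p over p ∈ ps, without division: every c with c p ≥ x/p is tested instead.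
Heavy : ℕ → List ℕ → Set
Heavy k ps = ∀ x (c : ℕ → ℕ) → All (λ p → x ≤ p * c p) ps → k * x ≤ 2 * ∑ ps c

heavy-++ : ∀ {k l ps qs} → Heavy k ps → Heavy l qs → Heavy (k + l) (ps ++ qs)
heavy-++ {k} {l} {ps} {qs} hp hq x c all = begin
  (k + l) * x                ≡⟨ *-distribʳ-+ x k l ⟩
  k * x + l * x              ≤⟨ +-mono-≤ (hp x c (All.++⁻ˡ ps all)) (hq x c (All.++⁻ʳ ps all)) ⟩
  2 * ∑ ps c + 2 * ∑ qs c    ≡⟨ *-distribˡ-+ 2 (∑ ps c) (∑ qs c) ⟨
  2 * (∑ ps c + ∑ qs c)      ≡⟨ cong (2 *_) (∑-++ ps qs c) ⟨
  2 * ∑ (ps ++ qs) c         ∎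

heavy-from-counts : ∀ {ps} y (c₀ : ℕ → ℕ) → .{{NonZero y}} →
  All (λ p → p * c₀ p ≤ y) ps → y ≤ 2 * ∑ ps c₀ → Heavy 1 ps
heavy-from-counts {ps} y c₀ upper total x c lower = *-cancelˡ-≤ y (begin
  y * (1 * x)                ≡⟨ cong (y *_) (*-identityˡ x) ⟩
  y * x                      ≤⟨ *-monoˡ-≤ x total ⟩
  2 * ∑ ps c₀ * x            ≡⟨ swap₁ 2 (∑ ps c₀) x ⟩
  2 * (x * ∑ ps c₀)          ≡⟨ cong (2 *_) (∑-distribˡ-* ps x c₀) ⟨
  2 * ∑ ps (λ p → x * c₀ p)  ≤⟨ *-monoʳ-≤ 2 (∑-mono (All.zipWith pointwise (upper , lower))) ⟩
  2 * ∑ ps (λ p → y * c p)   ≡⟨ cong (2 *_) (∑-distribˡ-* ps y c) ⟩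
  2 * (y * ∑ ps c)           ≡⟨ swap₂ 2 y (∑ ps c) ⟩
  y * (2 * ∑ ps c)           ∎)
  where
  swap₁ : ∀ a b c → a * b * c ≡ a * (c * b)
  swap₁ = solve-∀
  swap₂ : ∀ a b c → a * (b * c) ≡ b * (a * c)
  swap₂ = solve-∀
  swap₃ : ∀ a b c → a * b * c ≡ a * c * b
  swap₃ = solve-∀
  pointwise : ∀ {p} → p * c₀ p ≤ y × x ≤ p * c p → x * c₀ p ≤ y * c p
  pointwise {p} (u , l) = begin
    x * c₀ p        ≤⟨ *-monoˡ-≤ (c₀ p) l ⟩
    p * c p * c₀ p  ≡⟨ swap₃ p (c p) (c₀ p) ⟩
    p * c₀ p * c p  ≤⟨ *-monoˡ-≤ (c p) u ⟩
    y * c p         ∎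

square-cancel-≤ : ∀ {s z} → s * s ≤ z * z → s ≤ z
square-cancel-≤ {s} {z} le with s ≤? z
... | yes s≤z = s≤z
... | no s≰z = contradiction (*-mono-< (≰⇒> s≰z) (≰⇒> s≰z)) (≤⇒≯ le)

-- Erdős: up to y = (2 N!)², at most y/2 numbers r s² with r ∣ N! exist, and every
-- other number has a prime factor in [N, N + y].
primes-heavy : ∀ N → ∃[ x ] Heavy 1 (primesBetween N x)
primes-heavy N = suc y , heavy-from-counts {ps} y c₀ {{y≢0}}
  (All.map (λ {p} pp → multiples-≤ p y {{prime⇒nonZero pp}}) (All.all-filter prime? (applyUpTo (N +_) (suc y))))
  (+-cancelˡ-≤ y _ _ (begin
    y + y                          ≡⟨ double y ⟩
    2 * y                          ≡⟨ cong (2 *_) (trans (∑-upTo-const y 1) (*-identityʳ y)) ⟨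
    2 * ∑ (upTo y) (λ _ → 1)       ≤⟨ *-monoʳ-≤ 2 (∑-mono (All.map cover (All.all-upTo y))) ⟩
    2 * ∑ (upTo y) (λ i → rough i + smooth i)
      ≡⟨ cong (2 *_) (∑-distrib-+ (upTo y) rough smooth) ⟩
    2 * (∑ (upTo y) rough + ∑ (upTo y) smooth)
      ≤⟨ *-monoʳ-≤ 2 (+-mono-≤ (≤-reflexive (∑-swap (upTo y) ps (λ i p → ⟦ p ∣? suc i ⟧))) smooth≤) ⟩
    2 * (∑ ps c₀ + R * z)          ≡⟨ rearrange (∑ ps c₀) R ⟩
    y + 2 * ∑ ps c₀                ∎))
  where
  R = N !
  z = 2 * R
  y = z * z
  ps = primesBetween N (suc y)
  c₀ : ℕ → ℕ
  c₀ p = ∑ (upTo y) (λ i → ⟦ p ∣? suc i ⟧)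
  instance
    R≢0 : NonZero R
    R≢0 = N !≢0
    z≢0 : NonZero z
    z≢0 = m*n≢0 2 R
  y≢0 : NonZero y
  y≢0 = m*n≢0 z z
  rough smooth : ℕ → ℕ
  rough i = ∑ ps (λ p → ⟦ p ∣? suc i ⟧)
  smooth i = ∑ (upTo R) λ r → ∑ (upTo z) λ s → ⟦ suc i ≟ suc r * (suc s * suc s) ⟧
  double : ∀ y → y + y ≡ 2 * y
  double = solve-∀
  rearrange : ∀ c R → 2 * (c + R * (2 * R)) ≡ 2 * R * (2 * R) + 2 * c
  rearrange = solve-∀

  cover : ∀ {i} → i < y → 1 ≤ rough i + smooth i
  cover {i} i<y with roughOrDecomposed N y (suc i) i<y
  ... | inj₁ any = ≤-trans (Any⇒1≤∑ (λ p → p ∣? suc i) any) (m≤m+n _ _)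
  cover {i} i<y | inj₂ (zero , s , _ , ())
  cover {i} i<y | inj₂ (suc r , zero , _ , eq) = contradiction (trans eq (*-zeroʳ (suc r))) λ ()
  cover {i} i<y | inj₂ (suc r , suc s , r∣R , eq) = begin
    1                                                ≡⟨ ⟦⟧-true (suc i ≟ suc r * (suc s * suc s)) eq ⟨
    ⟦ suc i ≟ suc r * (suc s * suc s) ⟧              ≤⟨ ∈⇒≤∑ (λ s → ⟦ suc i ≟ suc r * (suc s * suc s) ⟧) (∈-upTo⁺ s<z) ⟩
    (∑ (upTo z) λ s → ⟦ suc i ≟ suc r * (suc s * suc s) ⟧)
      ≤⟨ ∈⇒≤∑ (λ r → ∑ (upTo z) λ s → ⟦ suc i ≟ suc r * (suc s * suc s) ⟧) (∈-upTo⁺ (∣⇒≤ r∣R)) ⟩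
    smooth i                                         ≤⟨ m≤n+m _ (rough i) ⟩
    rough i + smooth i                               ∎
    where
    s<z : suc s ≤ z
    s<z = square-cancel-≤ (begin
      suc s * suc s            ≤⟨ m≤n*m (suc s * suc s) (suc r) ⟩
      suc r * (suc s * suc s)  ≡⟨ eq ⟨
      suc i                    ≤⟨ i<y ⟩
      z * z                    ∎)

  smooth≤ : ∑ (upTo y) smooth ≤ R * z
  smooth≤ = begin
    ∑ (upTo y) smooth
      ≡⟨ ∑-swap (upTo y) (upTo R) (λ i r → ∑ (upTo z) λ s → ⟦ suc i ≟ suc r * (suc s * suc s) ⟧) ⟩
    (∑ (upTo R) λ r → ∑ (upTo y) λ i → ∑ (upTo z) λ s → ⟦ suc i ≟ suc r * (suc s * suc s) ⟧)
      ≤⟨ ∑-mono (All.universal bound (upTo R)) ⟩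
    ∑ (upTo R) (λ _ → z)  ≡⟨ ∑-upTo-const R z ⟩
    R * z                 ∎
    where
    bound : ∀ r → (∑ (upTo y) λ i → ∑ (upTo z) λ s → ⟦ suc i ≟ suc r * (suc s * suc s) ⟧) ≤ z
    bound r = begin
      (∑ (upTo y) λ i → ∑ (upTo z) λ s → ⟦ suc i ≟ suc r * (suc s * suc s) ⟧)
        ≡⟨ ∑-swap (upTo y) (upTo z) (λ i s → ⟦ suc i ≟ suc r * (suc s * suc s) ⟧) ⟩
      (∑ (upTo z) λ s → ∑ (upTo y) λ i → ⟦ suc i ≟ suc r * (suc s * suc s) ⟧)
        ≤⟨ ∑-mono (All.universal (λ s → ∑⟦≡⟧≤1 y (suc r * (suc s * suc s))) (upTo z)) ⟩
      ∑ (upTo z) (λ _ → 1)  ≡⟨ ∑-upTo-const z 1 ⟩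
      z * 1                 ≡⟨ *-identityʳ z ⟩
      z                     ∎

∑1/p-diverges : ∀ k N →
  ∃[ ps ] (All Prime ps × All (N ≤_) ps × AllPairs _<_ ps × Heavy k ps)
∑1/p-diverges zero    N = [] , [] , [] , [] , λ _ _ _ → z≤n
∑1/p-diverges (suc k) N with primes-heavy N
... | x , heavy with ∑1/p-diverges k (N + x)
...   | qs , qs-prime , qs-≥ , qs-< , qs-heavy =
  ps ++ qs
  , All.++⁺ (All.all-filter prime? interval) qs-prime
  , All.++⁺ (All.filter⁺ prime? (All.applyUpTo⁺₂ (N +_) x (m≤m+n N))) (All.map (≤-trans (m≤m+n N x)) qs-≥)
  , AllPairs.++⁺ (AllPairs.filter⁺ prime? (AllPairs.applyUpTo⁺₁ (N +_) x (λ i<j _ → +-monoʳ-< N i<j))) qs-<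
      (All.map (λ p< → All.map (≤-trans p<) qs-≥) (All.filter⁺ prime? (All.applyUpTo⁺₁ (N +_) x (+-monoʳ-< N))))
  , heavy-++ {1} {k} {ps} heavy qs-heavy
  where
  interval = applyUpTo (N +_) x
  ps = primesBetween N x

∑1/p²-bound : ∀ y {ps} (c : ℕ → ℕ) n → All (y <_) ps → AllPairs _<_ ps →
  All (λ p → p * p * c p ≤ n) ps → y * ∑ ps c ≤ n
∑1/p²-bound y c n [] [] [] = ≤-trans (≤-reflexive (*-zeroʳ y)) z≤n
∑1/p²-bound y {p ∷ ps} c n (y<p ∷ _) (p<ps ∷ ps<) (cp≤ ∷ c≤) = *-cancelˡ-≤ (p * p) {{m*n≢0 p p}} (begin
  p * p * (y * (c p + ∑ ps c))               ≡⟨ expand p y (c p) (∑ ps c) ⟩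
  y * (p * p * c p) + p * y * (p * ∑ ps c)   ≤⟨ +-mono-≤ (*-monoʳ-≤ y cp≤) (*-monoʳ-≤ (p * y) (∑1/p²-bound p c n p<ps ps< c≤)) ⟩
  y * n + p * y * n                          ≡⟨ factor p y n ⟩
  (y + p * y) * n                            ≤⟨ *-monoˡ-≤ n key ⟩
  p * p * n                                  ∎)
  where
  instance
    p≢0 : NonZero p
    p≢0 = >-nonZero (≤-<-trans z≤n y<p)
  expand : ∀ p y c s → p * p * (y * (c + s)) ≡ y * (p * p * c) + p * y * (p * s)
  expand = solve-∀
  factor : ∀ p y n → y * n + p * y * n ≡ (y + p * y) * n
  factor = solve-∀
  key : y + p * y ≤ p * p
  key = begin
    y + p * y  ≤⟨ +-monoˡ-≤ (p * y) (<⇒≤ y<p) ⟩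
    p + p * y  ≡⟨ *-suc p y ⟨
    p * suc y  ≤⟨ *-monoʳ-≤ p y<p ⟩
    p * p      ∎

-- Moments of ω

ω : List ℕ → ℕ → ℕ
ω ps a = ∑ ps (λ p → ⟦ p ∣? a ⟧)

multiplesBelow : ℕ → ℕ → ℕ
multiplesBelow n d = ∑ (upTo n) (λ a → ⟦ d ∣? a ⟧)

∑ω≡∑multiples : ∀ n ps → ∑ (upTo n) (ω ps) ≡ ∑ ps (multiplesBelow n)
∑ω≡∑multiples n ps = ∑-swap (upTo n) ps (λ a p → ⟦ p ∣? a ⟧)

<-primes-*-∣ : ∀ {p q a} → Prime p → Prime q → p < q → p ∣ a → q ∣ a → p * q ∣ a
<-primes-*-∣ {p} {q} pp pq p<q p∣a (divides k refl) with euclidsLemma k q pp p∣a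
... | inj₁ p∣k = *-monoˡ-∣ q p∣k
... | inj₂ p∣q = contradiction (composite p<q p∣q) (prime⇒¬composite pq)
  where instance _ = prime⇒nonTrivial pp

independence : ∀ {n p q} → Prime p → Prime q → p < q → p * q ∣ n →
  n * ∑ (upTo n) (λ a → ⟦ p ∣? a ⟧ * ⟦ q ∣? a ⟧) ≡ multiplesBelow n p * multiplesBelow n q
independence {n} {p} {q} pp pq p<q pq∣n = *-cancelˡ-≡ _ _ (p * q) (begin-equality
  p * q * (n * ∑ (upTo n) (λ a → ⟦ p ∣? a ⟧ * ⟦ q ∣? a ⟧))
    ≡⟨ cong (λ s → p * q * (n * s)) (∑-cong (All.universal both (upTo n))) ⟩
  p * q * (n * multiplesBelow n (p * q))    ≡⟨ rearrange₁ (p * q) n (multiplesBelow n (p * q)) ⟩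
  n * (p * q * multiplesBelow n (p * q))    ≡⟨ cong (n *_) (multiples-mod pq∣n) ⟩
  n * n                                     ≡⟨ cong₂ _*_ (multiples-mod (m*n∣⇒m∣ p q pq∣n)) (multiples-mod (m*n∣⇒n∣ p q pq∣n)) ⟨
  p * multiplesBelow n p * (q * multiplesBelow n q)
    ≡⟨ rearrange₂ p (multiplesBelow n p) q (multiplesBelow n q) ⟩
  p * q * (multiplesBelow n p * multiplesBelow n q) ∎)
  where
  instance
    p≢0 : NonZero p
    p≢0 = prime⇒nonZero pp
    q≢0 : NonZero q
    q≢0 = prime⇒nonZero pq
    pq≢0 : NonZero (p * q)
    pq≢0 = m*n≢0 p q
  both : ∀ a → ⟦ p ∣? a ⟧ * ⟦ q ∣? a ⟧ ≡ ⟦ p * q ∣? a ⟧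
  both a = trans (⟦⟧-*-× (p ∣? a) (q ∣? a)) (⟦⟧-cong (p ∣? a ×-dec q ∣? a) (p * q ∣? a)
    (λ (p∣a , q∣a) → <-primes-*-∣ pp pq p<q p∣a q∣a)
    (λ pq∣a → m*n∣⇒m∣ p q pq∣a , m*n∣⇒n∣ p q pq∣a))
  rearrange₁ : ∀ a b c → a * (b * c) ≡ b * (a * c)
  rearrange₁ = solve-∀
  rearrange₂ : ∀ a b c d → a * b * (c * d) ≡ a * c * (b * d)
  rearrange₂ = solve-∀

crossMoment : ∀ {n p ps} → Prime p → All Prime ps → All (p <_) ps → All (λ q → p * q ∣ n) ps →
  n * ∑ (upTo n) (λ a → ⟦ p ∣? a ⟧ * ω ps a) ≡ multiplesBelow n p * ∑ (upTo n) (ω ps)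
crossMoment {n} {p} {ps} pp pps p< pq∣n = begin-equality
  n * ∑ (upTo n) (λ a → ⟦ p ∣? a ⟧ * ω ps a)
    ≡⟨ cong (n *_) (∑-cong (All.universal (λ a → ∑-distribˡ-* ps ⟦ p ∣? a ⟧ (λ q → ⟦ q ∣? a ⟧)) (upTo n))) ⟨
  n * ∑ (upTo n) (λ a → ∑ ps (λ q → ⟦ p ∣? a ⟧ * ⟦ q ∣? a ⟧))
    ≡⟨ cong (n *_) (∑-swap (upTo n) ps (λ a q → ⟦ p ∣? a ⟧ * ⟦ q ∣? a ⟧)) ⟩
  n * ∑ ps (λ q → ∑ (upTo n) (λ a → ⟦ p ∣? a ⟧ * ⟦ q ∣? a ⟧))
    ≡⟨ ∑-distribˡ-* ps n (λ q → ∑ (upTo n) (λ a → ⟦ p ∣? a ⟧ * ⟦ q ∣? a ⟧)) ⟨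
  ∑ ps (λ q → n * ∑ (upTo n) (λ a → ⟦ p ∣? a ⟧ * ⟦ q ∣? a ⟧))
    ≡⟨ ∑-cong (All.zipWith (λ (pq , p<q , d) → independence pp pq p<q d) (pps , All.zip (p< , pq∣n))) ⟩
  ∑ ps (λ q → multiplesBelow n p * multiplesBelow n q)
    ≡⟨ ∑-distribˡ-* ps (multiplesBelow n p) (multiplesBelow n) ⟩
  multiplesBelow n p * ∑ ps (multiplesBelow n)
    ≡⟨ cong (multiplesBelow n p *_) (∑ω≡∑multiples n ps) ⟨
  multiplesBelow n p * ∑ (upTo n) (ω ps) ∎

secondMoment : ∀ {n ps} → All Prime ps → AllPairs _<_ ps → AllPairs (λ p q → p * q ∣ n) ps →
  n * ∑ (upTo n) (λ a → ω ps a * ω ps a) ≤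
  n * ∑ (upTo n) (ω ps) + ∑ (upTo n) (ω ps) * ∑ (upTo n) (ω ps)
secondMoment {n} {[]} [] [] [] =
  ≤-trans (*-monoʳ-≤ n (≤-reflexive refl)) (m≤m+n _ _)
secondMoment {n} {p ∷ ps} (pp ∷ pps) (p< ∷ ps<) (pq∣n ∷ pqs∣n) = begin
  n * ∑ (upTo n) (λ a → ω (p ∷ ps) a * ω (p ∷ ps) a)
    ≡⟨ cong (n *_) (∑-cong (All.universal square (upTo n))) ⟩
  n * ∑ (upTo n) (λ a → χ a + 2 * (χ a * w a) + w a * w a)
    ≡⟨ cong (n *_) (∑-distrib-+ (upTo n) (λ a → χ a + 2 * (χ a * w a)) (λ a → w a * w a)) ⟩
  n * (∑ (upTo n) (λ a → χ a + 2 * (χ a * w a)) + W₂)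
    ≡⟨ cong (λ s → n * (s + W₂)) (∑-distrib-+ (upTo n) χ (λ a → 2 * (χ a * w a))) ⟩
  n * (C + ∑ (upTo n) (λ a → 2 * (χ a * w a)) + W₂)
    ≡⟨ cong (λ s → n * (C + s + W₂)) (∑-distribˡ-* (upTo n) 2 (λ a → χ a * w a)) ⟩
  n * (C + 2 * X + W₂)               ≡⟨ expand n C X W₂ ⟩
  n * C + 2 * (n * X) + n * W₂       ≤⟨ +-mono-≤ (≤-reflexive (cong (λ s → n * C + 2 * s) (crossMoment pp pps p< pq∣n)))
                                                  (secondMoment pps ps< pqs∣n) ⟩
  n * C + 2 * (C * W) + (n * W + W * W)              ≤⟨ m≤m+n _ (C * C) ⟩
  n * C + 2 * (C * W) + (n * W + W * W) + C * C      ≡⟨ complete n C W ⟩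
  n * (C + W) + (C + W) * (C + W)
    ≡⟨ cong (λ s → n * s + s * s) (∑-distrib-+ (upTo n) χ w) ⟨
  n * ∑ (upTo n) (ω (p ∷ ps)) + ∑ (upTo n) (ω (p ∷ ps)) * ∑ (upTo n) (ω (p ∷ ps)) ∎
  where
  χ w : ℕ → ℕ
  χ a = ⟦ p ∣? a ⟧
  w = ω ps
  C = ∑ (upTo n) χ
  W = ∑ (upTo n) w
  X = ∑ (upTo n) (λ a → χ a * w a)
  W₂ = ∑ (upTo n) (λ a → w a * w a)
  expand : ∀ n c x w → n * (c + 2 * x + w) ≡ n * c + 2 * (n * x) + n * w
  expand = solve-∀
  complete : ∀ n c w → n * c + 2 * (c * w) + (n * w + w * w) + c * c ≡ n * (c + w) + (c + w) * (c + w)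
  complete = solve-∀
  square : ∀ a → (χ a + w a) * (χ a + w a) ≡ χ a + 2 * (χ a * w a) + w a * w a
  square a with p ∣? a
  ... | yes _ = one (w a)
    where
    one : ∀ w → (1 + w) * (1 + w) ≡ 1 + 2 * (1 * w) + w * w
    one = solve-∀
  ... | no _  = refl

∣-∣-square : ∀ u v → ∣ u - v ∣ * ∣ u - v ∣ + 2 * (u * v) ≡ u * u + v * v
∣-∣-square u v with ≤-total u v
... | inj₁ u≤v with m≤n⇒∃[o]m+o≡n u≤v
...   | o , refl rewrite ∣m-m+n∣≡n u o = identity u o
  where
  identity : ∀ u o → o * o + 2 * (u * (u + o)) ≡ u * u + (u + o) * (u + o)
  identity = solve-∀
∣-∣-square u v | inj₂ v≤u with m≤n⇒∃[o]m+o≡n v≤u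
...   | o , refl rewrite ∣-∣-comm (v + o) v | ∣m-m+n∣≡n v o = identity v o
  where
  identity : ∀ v o → o * o + 2 * ((v + o) * v) ≡ (v + o) * (v + o) + v * v
  identity = solve-∀

variance-≤ : ∀ n (f : ℕ → ℕ) → let M = ∑ (upTo n) f in
  n * ∑ (upTo n) (λ a → f a * f a) ≤ n * M + M * M →
  ∑ (upTo n) (λ a → ∣ n * f a - M ∣ * ∣ n * f a - M ∣) ≤ n * n * M
variance-≤ n f second = +-cancelʳ-≤ (2 * n * M * M) V (n * n * M) (begin
  V + 2 * n * M * M
    ≡⟨ cong (V +_) (∑-distribˡ-* (upTo n) (2 * n * M) f) ⟨
  V + ∑ (upTo n) (λ a → 2 * n * M * f a)
    ≡⟨ ∑-distrib-+ (upTo n) (λ a → dev a * dev a) (λ a → 2 * n * M * f a) ⟨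
  ∑ (upTo n) (λ a → dev a * dev a + 2 * n * M * f a)
    ≡⟨ ∑-cong (All.universal pointwise (upTo n)) ⟩
  ∑ (upTo n) (λ a → n * n * (f a * f a) + M * M)
    ≡⟨ ∑-distrib-+ (upTo n) (λ a → n * n * (f a * f a)) (λ _ → M * M) ⟩
  ∑ (upTo n) (λ a → n * n * (f a * f a)) + ∑ (upTo n) (λ _ → M * M)
    ≡⟨ cong₂ _+_ (∑-distribˡ-* (upTo n) (n * n) (λ a → f a * f a)) (∑-upTo-const n (M * M)) ⟩
  n * n * F₂ + n * (M * M)            ≡⟨ cong (_+ n * (M * M)) (*-assoc n n F₂) ⟩
  n * (n * F₂) + n * (M * M)          ≤⟨ +-monoˡ-≤ (n * (M * M)) (*-monoʳ-≤ n second) ⟩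
  n * (n * M + M * M) + n * (M * M)   ≡⟨ collect n M ⟩
  n * n * M + 2 * n * M * M           ∎)
  where
  M = ∑ (upTo n) f
  dev : ℕ → ℕ
  dev a = ∣ n * f a - M ∣
  V = ∑ (upTo n) (λ a → dev a * dev a)
  F₂ = ∑ (upTo n) (λ a → f a * f a)
  collect : ∀ n M → n * (n * M + M * M) + n * (M * M) ≡ n * n * M + 2 * n * M * M
  collect = solve-∀
  cross : ∀ n M f → 2 * n * M * f ≡ 2 * (n * f * M)
  cross = solve-∀
  squares : ∀ n M f → n * f * (n * f) + M * M ≡ n * n * (f * f) + M * M
  squares = solve-∀
  pointwise : ∀ a → dev a * dev a + 2 * n * M * f a ≡ n * n * (f a * f a) + M * M
  pointwise a = begin-equality
    dev a * dev a + 2 * n * M * f a    ≡⟨ cong (dev a * dev a +_) (cross n M (f a)) ⟩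
    dev a * dev a + 2 * (n * f a * M)  ≡⟨ ∣-∣-square (n * f a) M ⟩
    n * f a * (n * f a) + M * M        ≡⟨ squares n M (f a) ⟩
    n * n * (f a * f a) + M * M        ∎

chebyshev : ∀ D n (f : ℕ → ℕ) → let M = ∑ (upTo n) f in .{{NonZero M}} →
  n * ∑ (upTo n) (λ a → f a * f a) ≤ n * M + M * M →
  ∑ (upTo n) (λ a → ⟦ M <? D * ∣ n * f a - M ∣ ⟧) * M ≤ D * D * n * n
chebyshev D n f second = *-cancelˡ-≤ M (begin
  M * (∑ (upTo n) β * M)                     ≡⟨ rearrange₁ M (∑ (upTo n) β) ⟩
  M * M * ∑ (upTo n) β                       ≡⟨ ∑-distribˡ-* (upTo n) (M * M) β ⟨
  ∑ (upTo n) (λ a → M * M * β a)             ≤⟨ ∑-mono (All.universal pointwise (upTo n)) ⟩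
  ∑ (upTo n) (λ a → D * D * (dev a * dev a)) ≡⟨ ∑-distribˡ-* (upTo n) (D * D) (λ a → dev a * dev a) ⟩
  D * D * ∑ (upTo n) (λ a → dev a * dev a)   ≤⟨ *-monoʳ-≤ (D * D) (variance-≤ n f second) ⟩
  D * D * (n * n * M)                        ≡⟨ rearrange₂ D n M ⟩
  M * (D * D * n * n)                        ∎)
  where
  M = ∑ (upTo n) f
  dev β : ℕ → ℕ
  dev a = ∣ n * f a - M ∣
  β a = ⟦ M <? D * dev a ⟧
  rearrange₁ : ∀ M b → M * (b * M) ≡ M * M * b
  rearrange₁ = solve-∀
  rearrange₂ : ∀ D n M → D * D * (n * n * M) ≡ M * (D * D * n * n)
  rearrange₂ = solve-∀
  regroup : ∀ D d → D * d * (D * d) ≡ D * D * (d * d)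
  regroup = solve-∀
  pointwise : ∀ a → M * M * β a ≤ D * D * (dev a * dev a)
  pointwise a with M <? D * dev a
  ... | yes M< = begin
    M * M * 1                  ≡⟨ *-identityʳ (M * M) ⟩
    M * M                      ≤⟨ *-mono-≤ (<⇒≤ M<) (<⇒≤ M<) ⟩
    D * dev a * (D * dev a)    ≡⟨ regroup D (dev a) ⟩
    D * D * (dev a * dev a)    ∎
  ... | no _   = ≤-trans (≤-reflexive (*-zeroʳ (M * M))) z≤n

-- Product-free sets of typical residues

^-*-distrib : ∀ m n o → (m * n) ^ o ≡ m ^ o * n ^ o
^-*-distrib m n zero    = refl
^-*-distrib m n (suc o) = trans (cong (m * n *_) (^-*-distrib m n o)) (rearrange m n (m ^ o) (n ^ o))
  where
  rearrange : ∀ a b c d → a * b * (c * d) ≡ a * c * (b * d)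
  rearrange = solve-∀

^-monoˡ-∣ : ∀ {m n} o → m ∣ n → m ^ o ∣ n ^ o
^-monoˡ-∣ {m} o (divides q refl) = divides (q ^ o) (^-*-distrib q m o)

^-monoʳ-∣ : ∀ m {n o} → n ≤ o → m ^ n ∣ m ^ o
^-monoʳ-∣ m {n} n≤o with m≤n⇒∃[o]m+o≡n n≤o
... | k , refl = subst (m ^ n ∣_) (sym (^-distribˡ-+-* m n k)) (m∣m*n (m ^ k))

exponent-≤ : ∀ {p} v w {u} → .{{NonZero p}} → ¬ p ∣ u → p ^ v ∣ p ^ w * u → v ≤ w
exponent-≤ zero    w       p∤u d = z≤n
exponent-≤ {p} (suc v) zero {u} p∤u d =
  contradiction (subst (p ∣_) (*-identityˡ u) (m*n∣⇒m∣ p (p ^ v) d)) p∤u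
exponent-≤ {p} (suc v) (suc w) {u} p∤u d =
  s≤s (exponent-≤ v w p∤u (*-cancelˡ-∣ p (subst (p ^ suc v ∣_) (*-assoc p (p ^ w) u) d)))

count∣ : ℕ → List ℕ → ℕ
count∣ p as = ∑ as (λ a → ⟦ p ∣? a ⟧)

count∣≤length : ∀ p as → count∣ p as ≤ length as
count∣≤length p as = begin
  count∣ p as     ≤⟨ ∑-mono (All.universal (λ a → ⟦⟧≤1 (p ∣? a)) as) ⟩
  ∑ as (λ _ → 1)  ≡⟨ trans (∑-const as 1) (*-identityʳ (length as)) ⟩
  length as       ∎

product-valuation : ∀ {p as} → Prime p → All (λ a → ¬ p * p ∣ a) as →
  ∃[ u ] (product as ≡ p ^ count∣ p as * u × ¬ p ∣ u)
product-valuation {p} {[]} pp [] = 1 , refl , λ p∣1 → ¬prime[1] (subst Prime (∣1⇒≡1 p∣1) pp)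
product-valuation {p} {a ∷ as} pp (pp∤a ∷ pp∤as) with product-valuation pp pp∤as
... | u , eq , p∤u with p ∣? a
...   | no p∤a = a * u , trans (cong (a *_) eq) (rearrange a (p ^ count∣ p as) u)
               , [ p∤a , p∤u ]′ ∘ euclidsLemma a u pp
  where
  rearrange : ∀ a b c → a * (b * c) ≡ b * (a * c)
  rearrange = solve-∀
...   | yes (divides b refl) = b * u , trans (cong (b * p *_) eq) (rearrange b p (p ^ count∣ p as) u)
               , [ (λ p∣b → pp∤a (*-monoˡ-∣ p p∣b)) , p∤u ]′ ∘ euclidsLemma b u pp
  where
  rearrange : ∀ b p c u → b * p * (c * u) ≡ p * c * (b * u)
  rearrange = solve-∀

∣-resp-mod : ∀ {d n x y} → x ≡ y [mod n ] → d ∣ n → d ∣ x → d ∣ y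
∣-resp-mod {d} {n} {x} {y} x≡y d∣n d∣x =
  subst (d ∣_) (ℤ.∣-i∣≡∣i∣ (ℤ.+ y)) (ℤ.∣⇒∣ᵤ {ℤ.+ d} (ℤ.∣m+n∣m⇒∣n {ℤ.+ d} {ℤ.+ x} {ℤ.- ℤ.+ y}
    (ℤ.∣ᵤ⇒∣ {ℤ.+ d} {ℤ.+ x ℤ.- ℤ.+ y} (∣-trans d∣n x≡y)) (ℤ.∣ᵤ⇒∣ {ℤ.+ d} {ℤ.+ x} d∣x)))

mod-sym : ∀ {n x y} → x ≡ y [mod n ] → y ≡ x [mod n ]
mod-sym {n} {x} {y} = subst (n ∣_) (ℤ.∣i-j∣≡∣j-i∣ (ℤ.+ x) (ℤ.+ y))

count∣-≤ : ∀ {p n m as bs} → Prime p → p ^ m ∣ n → length as ≤ m →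
  All (λ a → ¬ p * p ∣ a) as → All (λ b → ¬ p * p ∣ b) bs →
  product as ≡ product bs [mod n ] → count∣ p as ≤ count∣ p bs
count∣-≤ {p} {n} {m} {as} {bs} pp p^m∣n len≤m pp∤as pp∤bs eq
  with product-valuation pp pp∤as | product-valuation pp pp∤bs
... | u , as≡ , _ | w , bs≡ , p∤w = exponent-≤ (count∣ p as) (count∣ p bs) {{prime⇒nonZero pp}} p∤w
  (subst (p ^ count∣ p as ∣_) bs≡ (∣-resp-mod {y = product bs} eq
    (∣-trans (^-monoʳ-∣ p (≤-trans (count∣≤length p as) len≤m)) p^m∣n)
    (subst (p ^ count∣ p as ∣_) (sym as≡) (m∣m*n u))))

Typical : List ℕ → ℕ → ℕ → ℕ → ℕ → Set
Typical ps D n M a = All (λ p → ¬ p * p ∣ a) ps × D * ∣ n * ω ps a - M ∣ ≤ M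

typical? : ∀ ps D n M a → Dec (Typical ps D n M a)
typical? ps D n M a = All.all? (λ p → ¬? (p * p ∣? a)) ps ×-dec D * ∣ n * ω ps a - M ∣ ≤? M

module _ {ps : List ℕ} {D n M : ℕ} where

  typical-lower : ∀ {as} → All (Typical ps D n M) as →
    length as * (D * M) ≤ D * (n * ∑ as (ω ps)) + length as * M
  typical-lower [] = z≤n
  typical-lower {a ∷ as} ((_ , close) ∷ ts) = begin
    D * M + l * (D * M)
      ≤⟨ +-mono-≤ (*-monoʳ-≤ D (m≤n+∣n-m∣ M (n * ω ps a))) (typical-lower ts) ⟩
    D * (n * ω ps a + ∣ n * ω ps a - M ∣) + (D * (n * s) + l * M)
      ≡⟨ cong (_+ (D * (n * s) + l * M)) (*-distribˡ-+ D (n * ω ps a) _) ⟩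
    D * (n * ω ps a) + D * ∣ n * ω ps a - M ∣ + (D * (n * s) + l * M)
      ≤⟨ +-monoˡ-≤ (D * (n * s) + l * M) (+-monoʳ-≤ (D * (n * ω ps a)) close) ⟩
    D * (n * ω ps a) + M + (D * (n * s) + l * M)
      ≡⟨ collect D n (ω ps a) M s (l * M) ⟩
    D * (n * (ω ps a + s)) + (M + l * M) ∎
    where
    l = length as
    s = ∑ as (ω ps)
    collect : ∀ D n w M s t → D * (n * w) + M + (D * (n * s) + t) ≡ D * (n * (w + s)) + (M + t)
    collect = solve-∀

  typical-upper : ∀ {as} → All (Typical ps D n M) as →
    D * (n * ∑ as (ω ps)) ≤ length as * (D * M + M)
  typical-upper [] = ≤-reflexive (trans (cong (D *_) (*-zeroʳ n)) (*-zeroʳ D))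
  typical-upper {a ∷ as} ((_ , close) ∷ ts) = begin
    D * (n * (ω ps a + s))                  ≡⟨ expand D n (ω ps a) s ⟩
    D * (n * ω ps a) + D * (n * s)          ≤⟨ +-mono-≤ (*-monoʳ-≤ D (m≤n+∣m-n∣ (n * ω ps a) M)) (typical-upper ts) ⟩
    D * (M + ∣ n * ω ps a - M ∣) + length as * (D * M + M)
      ≡⟨ cong (_+ length as * (D * M + M)) (*-distribˡ-+ D M _) ⟩
    D * M + D * ∣ n * ω ps a - M ∣ + length as * (D * M + M)
      ≤⟨ +-monoˡ-≤ (length as * (D * M + M)) (+-monoʳ-≤ (D * M) close) ⟩
    D * M + M + length as * (D * M + M)     ∎
    where
    s = ∑ as (ω ps)
    expand : ∀ D n w s → D * (n * (w + s)) ≡ D * (n * w) + D * (n * s)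
    expand = solve-∀

  typical-productFree : ∀ {m as bs} → .{{NonZero M}} → All Prime ps → All (λ p → p ^ m ∣ n) ps →
    length as ≤ m → length bs ≤ m → length bs < length as → length as + length bs < D →
    All (Typical ps D n M) as → All (Typical ps D n M) bs →
    ¬ (product as ≡ product bs [mod n ])
  typical-productFree {m} {as} {bs} pps p^m∣n as≤m bs≤m j<k k+j<D tas tbs eq =
    <⇒≱ k+j<D (+-cancelˡ-≤ (j * D) D (k + j) (begin
      j * D + D        ≡⟨ +-comm (j * D) D ⟩
      suc j * D        ≤⟨ *-monoˡ-≤ D j<k ⟩
      k * D            ≤⟨ *-cancelʳ-≤ (k * D) (j * D + (k + j)) M scaled ⟩
      j * D + (k + j)  ∎))
    where
    k = length as
    j = length bs
    squarefree : ∀ {cs p} → p ∈ ps → All (Typical ps D n M) cs → All (λ c → ¬ p * p ∣ c) cs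
    squarefree p∈ps = All.map (λ (sqf , _) → All.lookup sqf p∈ps)
    counts : ∀ {p} → p ∈ ps → count∣ p as ≡ count∣ p bs
    counts {p} p∈ps = ≤-antisym
      (count∣-≤ (All.lookup pps p∈ps) (All.lookup p^m∣n p∈ps) as≤m (squarefree p∈ps tas) (squarefree p∈ps tbs) eq)
      (count∣-≤ (All.lookup pps p∈ps) (All.lookup p^m∣n p∈ps) bs≤m (squarefree p∈ps tbs) (squarefree p∈ps tas)
        (mod-sym {x = product as} eq))
    ∑ω-equal : ∑ as (ω ps) ≡ ∑ bs (ω ps)
    ∑ω-equal = begin-equality
      ∑ as (ω ps)                ≡⟨ ∑-swap as ps (λ a p → ⟦ p ∣? a ⟧) ⟩
      ∑ ps (λ p → count∣ p as)   ≡⟨ ∑-cong (All.tabulate counts) ⟩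
      ∑ ps (λ p → count∣ p bs)   ≡⟨ ∑-swap bs ps (λ a p → ⟦ p ∣? a ⟧) ⟨
      ∑ bs (ω ps)                ∎
    scaled : k * D * M ≤ (j * D + (k + j)) * M
    scaled = begin
      k * D * M                              ≡⟨ *-assoc k D M ⟩
      k * (D * M)                            ≤⟨ typical-lower tas ⟩
      D * (n * ∑ as (ω ps)) + k * M          ≡⟨ cong (λ s → D * (n * s) + k * M) ∑ω-equal ⟩
      D * (n * ∑ bs (ω ps)) + k * M          ≤⟨ +-monoˡ-≤ (k * M) (typical-upper tbs) ⟩
      j * (D * M + M) + k * M                ≡⟨ collect j D M k ⟩
      (j * D + (k + j)) * M                  ∎
      where
      collect : ∀ j D M k → j * (D * M + M) + k * M ≡ (j * D + (k + j)) * M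
      collect = solve-∀

subset : ∀ {P : ℕ → Set} → (∀ a → Dec (P a)) → ∀ n → Subset n
subset P? n = tabulate (λ i → does (P? (toℕ i)))

∣subset∣ : ∀ {P : ℕ → Set} (P? : ∀ a → Dec (P a)) n → ∣ subset P? n ∣ ≡ ∑ (upTo n) (λ a → ⟦ P? a ⟧)
∣subset∣ P? zero = refl
∣subset∣ P? (suc n) with P? 0 | ∑-upTo-head n (λ a → ⟦ P? a ⟧) | ∣subset∣ (P? ∘ suc) n
... | yes _ | eq | ih = trans (cong suc ih) (sym eq)
... | no _  | eq | ih = trans ih (sym eq)

∈-subset : ∀ {P : ℕ → Set} (P? : ∀ a → Dec (P a)) {n} {i : Fin n} → i Subset.∈ subset P? n → P (toℕ i)
∈-subset P? {i = i} i∈S with P? (toℕ i) | trans (sym (Vec.lookup∘tabulate (does ∘ P? ∘ toℕ) i)) (Vec.[]=⇒lookup i∈S)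
... | yes p | _ = p

subset-productFree : ∀ {P : ℕ → Set} (P? : ∀ a → Dec (P a)) {n k j} →
  (∀ {as bs} → length as ≡ k → length bs ≡ j → All P as → All P bs → ¬ (product as ≡ product bs [mod n ])) →
  ProductFree k j (subset P? n)
subset-productFree {P} P? {n} free as bs as∈S bs∈S eq =
  free (len as) (len bs) (all as∈S) (all bs∈S) (subst₂ (_≡_[mod n ]) (∏≡ as) (∏≡ bs) eq)
  where
  reps : ∀ {k} → Vec (Fin n) k → List ℕ
  reps as = toList (Vec.map toℕ as)
  len : ∀ {k} (as : Vec (Fin n) k) → length (reps as) ≡ k
  len as = Vec.length-toList (Vec.map toℕ as)
  ∏≡ : ∀ {k} (as : Vec (Fin n) k) → ∏ as ≡ product (reps as)
  ∏≡ []       = refl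
  ∏≡ (a ∷ as) = cong (toℕ a *_) (∏≡ as)
  all : ∀ {k} {as : Vec (Fin n) k} → VecAll.All (Subset._∈ subset P? n) as → All P (reps as)
  all []        = []
  all (a∈ ∷ as∈) = ∈-subset P? a∈ ∷ all as∈

module _ {ps : List ℕ} {n : ℕ} (E D : ℕ) .{{_ : NonZero n}} .{{_ : NonZero D}}
  (primes : All Prime ps) (ascending : AllPairs _<_ ps) (large : All (2 * E <_) ps)
  (products∣n : AllPairs (λ p q → p * q ∣ n) ps) (squares∣n : All (λ p → p * p ∣ n) ps)
  where

  private
    M = ∑ (upTo n) (ω ps)
    squareful deviant : ℕ → ℕ
    squareful a = ∑ ps (λ p → ⟦ p * p ∣? a ⟧)
    deviant a = ⟦ M <? D * ∣ n * ω ps a - M ∣ ⟧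

  squareful-rare : 2 * E * ∑ (upTo n) squareful ≤ n
  squareful-rare = begin
    2 * E * ∑ (upTo n) squareful                   ≡⟨ cong (2 * E *_) (∑-swap (upTo n) ps (λ a p → ⟦ p * p ∣? a ⟧)) ⟩
    2 * E * ∑ ps (λ p → multiplesBelow n (p * p))
      ≤⟨ ∑1/p²-bound (2 * E) (λ p → multiplesBelow n (p * p)) n large ascending (All.zipWith exact (primes , squares∣n)) ⟩
    n ∎
    where
    exact : ∀ {p} → Prime p × p * p ∣ n → p * p * multiplesBelow n (p * p) ≤ n
    exact {p} (pp , pp∣n) = ≤-reflexive (multiples-mod {{m*n≢0 p p}} pp∣n)
      where instance _ = prime⇒nonZero pp

  deviant-rare : .{{NonZero M}} → 2 * E * (D * D * n) ≤ M → 2 * E * ∑ (upTo n) deviant ≤ n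
  deviant-rare M-large = *-cancelˡ-≤ (D * D * n) {{m*n≢0 (D * D) n {{m*n≢0 D D}}}} (begin
    D * D * n * (2 * E * C)    ≡⟨ rearrange (D * D * n) (2 * E) C ⟩
    C * (2 * E * (D * D * n))  ≤⟨ *-monoʳ-≤ C M-large ⟩
    C * M                      ≤⟨ chebyshev D n (ω ps) (secondMoment primes ascending products∣n) ⟩
    D * D * n * n              ∎)
    where
    C = ∑ (upTo n) deviant
    rearrange : ∀ a b c → a * (b * c) ≡ c * (b * a)
    rearrange = solve-∀

  typical-or-rare : ∀ a → 1 ≤ ⟦ typical? ps D n M a ⟧ + (squareful a + deviant a)
  typical-or-rare a with Any.any? (λ p → p * p ∣? a) ps | M <? D * ∣ n * ω ps a - M ∣
  ... | yes any | _     = ≤-trans (≤-trans (Any⇒1≤∑ (λ p → p * p ∣? a) any) (m≤m+n _ _)) (m≤n+m _ ⟦ typical? ps D n M a ⟧)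
  ... | no _    | yes _ = ≤-trans (m≤n+m 1 (squareful a)) (m≤n+m _ ⟦ typical? ps D n M a ⟧)
  ... | no none | no M≮ = ≤-trans (≤-reflexive (sym (⟦⟧-true (typical? ps D n M a) (All.¬Any⇒All¬ ps none , ≮⇒≥ M≮)))) (m≤m+n _ _)

  typical-dense : .{{NonZero M}} → 2 * E * (D * D * n) ≤ M →
    E * n ≤ E * ∑ (upTo n) (λ a → ⟦ typical? ps D n M a ⟧) + n
  typical-dense M-large = *-cancelˡ-≤ 2 (begin
    2 * (E * n)                                ≡⟨ *-assoc 2 E n ⟨
    2 * E * n                                  ≡⟨ cong (2 * E *_) (trans (∑-upTo-const n 1) (*-identityʳ n)) ⟨
    2 * E * ∑ (upTo n) (λ _ → 1)               ≤⟨ *-monoʳ-≤ (2 * E) (∑-mono (All.universal typical-or-rare (upTo n))) ⟩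
    2 * E * ∑ (upTo n) (λ a → typ a + (squareful a + deviant a))
      ≡⟨ cong (2 * E *_) (trans (∑-distrib-+ (upTo n) typ (λ a → squareful a + deviant a))
                                (cong (∑ (upTo n) typ +_) (∑-distrib-+ (upTo n) squareful deviant))) ⟩
    2 * E * (∑ (upTo n) typ + (∑ (upTo n) squareful + ∑ (upTo n) deviant))
      ≡⟨ expand E (∑ (upTo n) typ) (∑ (upTo n) squareful) (∑ (upTo n) deviant) ⟩
    2 * (E * ∑ (upTo n) typ) + (2 * E * ∑ (upTo n) squareful + 2 * E * ∑ (upTo n) deviant)
      ≤⟨ +-monoʳ-≤ (2 * (E * ∑ (upTo n) typ)) (+-mono-≤ squareful-rare (deviant-rare M-large)) ⟩
    2 * (E * ∑ (upTo n) typ) + (n + n)         ≡⟨ collect (E * ∑ (upTo n) typ) n ⟩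
    2 * (E * ∑ (upTo n) typ + n)               ∎)
    where
    typ : ℕ → ℕ
    typ a = ⟦ typical? ps D n M a ⟧
    expand : ∀ E t s d → 2 * E * (t + (s + d)) ≡ 2 * (E * t) + (2 * E * s + 2 * E * d)
    expand = solve-∀
    collect : ∀ t n → 2 * t + (n + n) ≡ 2 * (t + n)
    collect = solve-∀

dense-productFree : ∀ E m → 0 < E → 2 ≤ m → Σ[ n ∈ ℕ ] (0 < n × Σ[ S ∈ Subset n ]
  (E * n ≤ E * ∣ S ∣ + n ×
   (∀ k j → j < k → k + j ≤ m → ProductFree k j S)))
dense-productFree E m 0<E 2≤m
  with ∑1/p-diverges (2 * (2 * E * (suc m * suc m))) (suc (2 * E))
... | ps , primes , large , ascending , heavy =
  n , >-nonZero⁻¹ n , subset good? n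
  , subst (λ s → E * n ≤ E * s + n) (sym (∣subset∣ good? n))
      (typical-dense E D primes ascending large products∣n squares∣n {{M≢0}} M-large)
  , λ k j j<k k+j≤m → subset-productFree good? λ { refl refl tas tbs →
      typical-productFree {{M≢0}} primes powers∣n (m+n≤o⇒m≤o k k+j≤m) (m+n≤o⇒n≤o k k+j≤m) j<k (s≤s k+j≤m) tas tbs }
  where
  D = suc m
  N = product ps
  n = N ^ m
  instance
    n≢0 : NonZero n
    n≢0 = m^n≢0 N m {{productOfPrimes≢0 primes}}
    E≢0 : NonZero E
    E≢0 = >-nonZero 0<E
  M = ∑ (upTo n) (ω ps)
  good? = typical? ps D n M
  divides-N : All (_∣ N) ps
  divides-N = All.tabulate ∈⇒∣product
  N²∣n : N * N ∣ n
  N²∣n = subst (_∣ n) (cong (N *_) (*-identityʳ N)) (^-monoʳ-∣ N 2≤m)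
  powers∣n : All (λ p → p ^ m ∣ n) ps
  powers∣n = All.map (^-monoˡ-∣ m) divides-N
  squares∣n : All (λ p → p * p ∣ n) ps
  squares∣n = All.map (λ p∣N → ∣-trans (*-pres-∣ p∣N p∣N) N²∣n) divides-N
  pairs : ∀ {qs} → All (_∣ N) qs → AllPairs (λ p q → p * q ∣ n) qs
  pairs []        = []
  pairs (d ∷ ds)  = All.map (λ d′ → ∣-trans (*-pres-∣ d d′) N²∣n) ds ∷ pairs ds
  products∣n = pairs divides-N
  M-large : 2 * E * (D * D * n) ≤ M
  M-large = *-cancelˡ-≤ 2 (begin
    2 * (2 * E * (D * D * n))      ≡⟨ rearrange E (D * D) n ⟩
    2 * (2 * E * (D * D)) * n      ≤⟨ heavy n (multiplesBelow n) (All.map exact (All.zip (primes , divides-N))) ⟩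
    2 * ∑ ps (multiplesBelow n)    ≡⟨ cong (2 *_) (∑ω≡∑multiples n ps) ⟨
    2 * M                          ∎)
    where
    rearrange : ∀ E d n → 2 * (2 * E * (d * n)) ≡ 2 * (2 * E * d) * n
    rearrange = solve-∀
    exact : ∀ {p} → Prime p × p ∣ N → n ≤ p * multiplesBelow n p
    exact (pp , p∣N) = ≤-reflexive (sym (multiples-mod {{prime⇒nonZero pp}} (∣-trans p∣N (∣-trans (m∣m*n N) N²∣n))))
  M≢0 : NonZero M
  M≢0 = >-nonZero (<-≤-trans (>-nonZero⁻¹ _ {{m*n≢0 (2 * E) (D * D * n) {{m*n≢0 2 E}} {{m*n≢0 (D * D) n}}}}) M-large)

theorem3p1 : ∀ (ε : ℝ) → 0ℝ <ᵣ ε → ∀ (m : ℕ) → 3 ≤ m →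
    Σ[ n ∈ ℕ ] (0 < n ×
    Σ[ S ∈ Subset n ]
    ((1ℝ -ᵣ ε) *ᵣ fromℕ n ≤ᵣ fromℕ ∣ S ∣ ×
    (∀ (k j : ℕ) → 0 < k → 0 < j → j < k → k + j ≤ m → ProductFree k j S)))
-- Destructuring by let: a with-abstraction would normalise the Cauchy proofs in the goal.
theorem3p1 ε (δ , 0<δ , N , δ≤ε) m 3≤m =
  let E , 0<E , 1≤Eδ             = archimedean δ 0<δ
      n , 0<n , S , dense , free = dense-productFree E m 0<E (<⇒≤ 3≤m)
  in n , 0<n , S
   , (λ η 0<η → N , λ k N≤k → density-bound {E} {n} {∣ S ∣} 0<E dense 1≤Eδ (seq ε k) (δ≤ε k N≤k) η 0<η)
   , λ k j _ _ → free k j
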